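{- The set $(8,\underbrace{4,\dots,4}_{8},\underbrace{0,\dots,0}_{7})^{B_{16}}$ of all vectors in $\mathbb{R}^{16}$ obtained from $(8,4,4,4,4,4,4,4,4,0,0,0,0,0,0,0)$ by permuting coordinates and changing signs of coordinates (this is $(8\sqrt3\,v_{2,8})^{B_{16}}$) is contained in a single shell of the Barnes–Wall lattice $BW_{16}$, i.e. in $\{x\in BW_{16} : \|x\|^2=m\}$ for some $m$.
   Context: Here $v_{2,8}=12^{ -1/2}(2,1^8,0^7)\in\mathbb{R}^{16}$ and $B_{16}$ is the group of coordinate permutations and sign changes. The Barnes–Wall lattice $BW_{16}\subset\mathbb{R}^{16}$ is the set of integer linear combinations of the rows of the $16\times16$ matrix whose rows are: (4,0,0,0,0,0,0,0,0,0,0,0,0,0,0,0), (4,4,0,0,0,0,0,0,0,0,0,0,0,0,0,0), (4,0,4,0,0,0,0,0,0,0,0,0,0,0,0,0), (2,2,2,2,0,0,0,0,0,0,0,0,0,0,0,0), (4,0,0,0,4,0,0,0,0,0,0,0,0,0,0,0), (2,2,0,0,2,2,0,0,0,0,0,0,0,0,0,0), (2,0,2,0,2,0,2,0,0,0,0,0,0,0,0,0), (2,2,2,2,2,2,2,2,0,0,0,0,0,0,0,0), (4,0,0,0,0,0,0,0,4,0,0,0,0,0,0,0), (2,2,0,0,0,0,0,0,2,2,0,0,0,0,0,0), (2,0,2,0,0,0,0,0,2,0,2,0,0,0,0,0), (2,2,2,2,0,0,0,0,2,2,2,2,0,0,0,0), (2,0,0,0,2,0,0,0,2,0,0,0,2,0,0,0),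 (2,2,0,0,2,2,0,0,2,2,0,0,2,2,0,0), (2,0,2,0,2,0,2,0,2,0,2,0,2,0,2,0), (1,1,1,1,1,1,1,1,1,1,1,1,1,1,1,1). A shell of a lattice is the set of its vectors of a fixed squared norm. -}

module Defs where

open import Data.Nat using (ℕ; zero; suc)
open import Data.Integer using (ℤ; +_; -_; _+_; _*_)
open import Data.Fin using (Fin; zero; suc)
open import Data.Bool using (Bool; true; false)
open import Data.Vec using (Vec; []; _∷_; lookup)
open import Data.Product using (∃)
open import Data.Fin.Permutation using (Permutation′; _⟨$⟩ʳ_)
open import Relation.Binary.PropositionalEquality using (_≡_)

-- Vectors of ℤ^n (all vectors in this statement have integer coordinates).
Vector : ℕ → Set
Vector n = Fin n → ℤ

sumFin : ∀ n → (Fin n → ℤ) → ℤ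
sumFin zero    f = + 0
sumFin (suc n) f = f zero + sumFin n (λ i → f (suc i))

normSq : ∀ {n} → Vector n → ℤ
normSq {n} x = sumFin n (λ i → x i * x i)

bwRows : Vec (Vec ℤ 16) 16
bwRows =
    (+ 4 ∷ + 0 ∷ + 0 ∷ + 0 ∷ + 0 ∷ + 0 ∷ + 0 ∷ + 0 ∷ + 0 ∷ + 0 ∷ + 0 ∷ + 0 ∷ + 0 ∷ + 0 ∷ + 0 ∷ + 0 ∷ [])
  ∷ (+ 4 ∷ + 4 ∷ + 0 ∷ + 0 ∷ + 0 ∷ + 0 ∷ + 0 ∷ + 0 ∷ + 0 ∷ + 0 ∷ + 0 ∷ + 0 ∷ + 0 ∷ + 0 ∷ + 0 ∷ + 0 ∷ [])
  ∷ (+ 4 ∷ + 0 ∷ + 4 ∷ + 0 ∷ + 0 ∷ + 0 ∷ + 0 ∷ + 0 ∷ + 0 ∷ + 0 ∷ + 0 ∷ + 0 ∷ + 0 ∷ + 0 ∷ + 0 ∷ + 0 ∷ [])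
  ∷ (+ 2 ∷ + 2 ∷ + 2 ∷ + 2 ∷ + 0 ∷ + 0 ∷ + 0 ∷ + 0 ∷ + 0 ∷ + 0 ∷ + 0 ∷ + 0 ∷ + 0 ∷ + 0 ∷ + 0 ∷ + 0 ∷ [])
  ∷ (+ 4 ∷ + 0 ∷ + 0 ∷ + 0 ∷ + 4 ∷ + 0 ∷ + 0 ∷ + 0 ∷ + 0 ∷ + 0 ∷ + 0 ∷ + 0 ∷ + 0 ∷ + 0 ∷ + 0 ∷ + 0 ∷ [])
  ∷ (+ 2 ∷ + 2 ∷ + 0 ∷ + 0 ∷ + 2 ∷ + 2 ∷ + 0 ∷ + 0 ∷ + 0 ∷ + 0 ∷ + 0 ∷ + 0 ∷ + 0 ∷ + 0 ∷ + 0 ∷ + 0 ∷ [])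
  ∷ (+ 2 ∷ + 0 ∷ + 2 ∷ + 0 ∷ + 2 ∷ + 0 ∷ + 2 ∷ + 0 ∷ + 0 ∷ + 0 ∷ + 0 ∷ + 0 ∷ + 0 ∷ + 0 ∷ + 0 ∷ + 0 ∷ [])
  ∷ (+ 2 ∷ + 2 ∷ + 2 ∷ + 2 ∷ + 2 ∷ + 2 ∷ + 2 ∷ + 2 ∷ + 0 ∷ + 0 ∷ + 0 ∷ + 0 ∷ + 0 ∷ + 0 ∷ + 0 ∷ + 0 ∷ [])
  ∷ (+ 4 ∷ + 0 ∷ + 0 ∷ + 0 ∷ + 0 ∷ + 0 ∷ + 0 ∷ + 0 ∷ + 4 ∷ + 0 ∷ + 0 ∷ + 0 ∷ + 0 ∷ + 0 ∷ + 0 ∷ + 0 ∷ [])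
  ∷ (+ 2 ∷ + 2 ∷ + 0 ∷ + 0 ∷ + 0 ∷ + 0 ∷ + 0 ∷ + 0 ∷ + 2 ∷ + 2 ∷ + 0 ∷ + 0 ∷ + 0 ∷ + 0 ∷ + 0 ∷ + 0 ∷ [])
  ∷ (+ 2 ∷ + 0 ∷ + 2 ∷ + 0 ∷ + 0 ∷ + 0 ∷ + 0 ∷ + 0 ∷ + 2 ∷ + 0 ∷ + 2 ∷ + 0 ∷ + 0 ∷ + 0 ∷ + 0 ∷ + 0 ∷ [])
  ∷ (+ 2 ∷ + 2 ∷ + 2 ∷ + 2 ∷ + 0 ∷ + 0 ∷ + 0 ∷ + 0 ∷ + 2 ∷ + 2 ∷ + 2 ∷ + 2 ∷ + 0 ∷ + 0 ∷ + 0 ∷ + 0 ∷ [])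
  ∷ (+ 2 ∷ + 0 ∷ + 0 ∷ + 0 ∷ + 2 ∷ + 0 ∷ + 0 ∷ + 0 ∷ + 2 ∷ + 0 ∷ + 0 ∷ + 0 ∷ + 2 ∷ + 0 ∷ + 0 ∷ + 0 ∷ [])
  ∷ (+ 2 ∷ + 2 ∷ + 0 ∷ + 0 ∷ + 2 ∷ + 2 ∷ + 0 ∷ + 0 ∷ + 2 ∷ + 2 ∷ + 0 ∷ + 0 ∷ + 2 ∷ + 2 ∷ + 0 ∷ + 0 ∷ [])
  ∷ (+ 2 ∷ + 0 ∷ + 2 ∷ + 0 ∷ + 2 ∷ + 0 ∷ + 2 ∷ + 0 ∷ + 2 ∷ + 0 ∷ + 2 ∷ + 0 ∷ + 2 ∷ + 0 ∷ + 2 ∷ + 0 ∷ [])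
  ∷ (+ 1 ∷ + 1 ∷ + 1 ∷ + 1 ∷ + 1 ∷ + 1 ∷ + 1 ∷ + 1 ∷ + 1 ∷ + 1 ∷ + 1 ∷ + 1 ∷ + 1 ∷ + 1 ∷ + 1 ∷ + 1 ∷ [])
  ∷ []

InBW16 : Vector 16 → Set
InBW16 x = ∃ λ (c : Fin 16 → ℤ) →
  ∀ j → x j ≡ sumFin 16 (λ i → c i * lookup (lookup bwRows i) j)

sign : Bool → ℤ → ℤ
sign true  a = - a
sign false a = a

actB16 : Permutation′ 16 → (Fin 16 → Bool) → Vector 16 → Vector 16
actB16 π s x j = sign (s j) (x (π ⟨$⟩ʳ j))

base : Vector 16
base j = lookup (+ 8 ∷ + 4 ∷ + 4 ∷ + 4 ∷ + 4 ∷ + 4 ∷ + 4 ∷ + 4 ∷ + 4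
               ∷ + 0 ∷ + 0 ∷ + 0 ∷ + 0 ∷ + 0 ∷ + 0 ∷ + 0 ∷ []) j

InOrbit : Vector 16 → Set
InOrbit x = ∃ λ (π : Permutation′ 16) → ∃ λ (s : Fin 16 → Bool) →
  ∀ j → x j ≡ actB16 π s base j

{-# OPTIONS --safe #-}
-- BW₁₆ contains 4ℤ¹⁶: the i-th generator is d i times the indicator vector of the
-- binary submasks of i, with d i ∈ {4, 2, 1}, so the generator matrix is diag d times
-- the zeta matrix of the Boolean lattice of rank 4, and Möbius inversion expresses
-- every 4eₖ as an integer combination of the generators. All orbit vectors have
-- coordinates divisible by 4, and their norm is invariant under B₁₆.
module Submission where

open import Defs
open import Data.Bool using (true; false)
open import Data.Fin using (Fin; zero; suc)
open import Data.Fin.Properties using (all?)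
open import Data.Fin.Permutation using (_⟨$⟩ʳ_)
open import Data.Integer using (ℤ; +_; -[1+_]; -_; _+_; _*_; _≟_)
open import Data.Integer.Properties using
  (+-*-semiring; +-identityˡ; +-identityʳ; *-assoc; *-zeroʳ; *-identityʳ;
   neg-distribˡ-*; neg-distribʳ-*; neg-involutive)
open import Algebra.Properties.Semiring.Sum +-*-semiring using
  (sum; sum-cong-≗; sum-replicate-zero; ∑-comm; *-distribˡ-sum; *-distribʳ-sum; sum-permute)
open import Data.Nat using (zero; suc)
open import Data.Product using (Σ; _×_; _,_)
open import Data.Vec using (Vec; []; _∷_; lookup)
open import Relation.Binary.PropositionalEquality
open import Relation.Nullary.Decidable using (from-yes)

open ≡-Reasoning

-- Bridge to the semiring `sum`, whose laws on interchange, distributivity and reindexing carry both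
-- halves of the proof.
sumFin≡sum : ∀ n (f : Fin n → ℤ) → sumFin n f ≡ sum f
sumFin≡sum zero    f = refl
sumFin≡sum (suc n) f = cong (λ t → f zero + t) (sumFin≡sum n (λ i → f (suc i)))

δ : ∀ {n} → Fin n → Fin n → ℤ
δ zero    zero    = + 1
δ zero    (suc _) = + 0
δ (suc _) zero    = + 0
δ (suc i) (suc j) = δ i j

sum-*δ : ∀ {n} (f : Fin n → ℤ) j → sum (λ k → f k * δ k j) ≡ f j
sum-*δ {suc n} f zero = begin
  f zero * + 1 + sum (λ k → f (suc k) * + 0)  ≡⟨ cong₂ _+_ (*-identityʳ (f zero)) (sum-cong-≗ (λ k → *-zeroʳ (f (suc k)))) ⟩
  f zero + sum {n} (λ _ → + 0)                ≡⟨ cong (λ t → f zero + t) (sum-replicate-zero n) ⟩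
  f zero + + 0                                ≡⟨ +-identityʳ (f zero) ⟩
  f zero                                      ∎
sum-*δ f (suc j) = begin
  f zero * + 0 + sum (λ k → f (suc k) * δ k j)  ≡⟨ cong₂ _+_ (*-zeroʳ (f zero)) (sum-*δ (λ k → f (suc k)) j) ⟩
  + 0 + f (suc j)                               ≡⟨ +-identityˡ (f (suc j)) ⟩
  f (suc j)                                     ∎

generator : Fin 16 → Vector 16
generator i = lookup (lookup bwRows i)

-- The entry at (k , i) is (-1)^|k∖i| · 4 / d i if i is a submask of k, and 0 otherwise.
möbius : Vec (Vec ℤ 16) 16
möbius =
    (+ 1 ∷ + 0 ∷ + 0 ∷ + 0 ∷ + 0 ∷ + 0 ∷ + 0 ∷ + 0 ∷ + 0 ∷ + 0 ∷ + 0 ∷ + 0 ∷ + 0 ∷ + 0 ∷ + 0 ∷ + 0 ∷ [])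
  ∷ (-[1+ 0 ] ∷ + 1 ∷ + 0 ∷ + 0 ∷ + 0 ∷ + 0 ∷ + 0 ∷ + 0 ∷ + 0 ∷ + 0 ∷ + 0 ∷ + 0 ∷ + 0 ∷ + 0 ∷ + 0 ∷ + 0 ∷ [])
  ∷ (-[1+ 0 ] ∷ + 0 ∷ + 1 ∷ + 0 ∷ + 0 ∷ + 0 ∷ + 0 ∷ + 0 ∷ + 0 ∷ + 0 ∷ + 0 ∷ + 0 ∷ + 0 ∷ + 0 ∷ + 0 ∷ + 0 ∷ [])
  ∷ (+ 1 ∷ -[1+ 0 ] ∷ -[1+ 0 ] ∷ + 2 ∷ + 0 ∷ + 0 ∷ + 0 ∷ + 0 ∷ + 0 ∷ + 0 ∷ + 0 ∷ + 0 ∷ + 0 ∷ + 0 ∷ + 0 ∷ + 0 ∷ [])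
  ∷ (-[1+ 0 ] ∷ + 0 ∷ + 0 ∷ + 0 ∷ + 1 ∷ + 0 ∷ + 0 ∷ + 0 ∷ + 0 ∷ + 0 ∷ + 0 ∷ + 0 ∷ + 0 ∷ + 0 ∷ + 0 ∷ + 0 ∷ [])
  ∷ (+ 1 ∷ -[1+ 0 ] ∷ + 0 ∷ + 0 ∷ -[1+ 0 ] ∷ + 2 ∷ + 0 ∷ + 0 ∷ + 0 ∷ + 0 ∷ + 0 ∷ + 0 ∷ + 0 ∷ + 0 ∷ + 0 ∷ + 0 ∷ [])
  ∷ (+ 1 ∷ + 0 ∷ -[1+ 0 ] ∷ + 0 ∷ -[1+ 0 ] ∷ + 0 ∷ + 2 ∷ + 0 ∷ + 0 ∷ + 0 ∷ + 0 ∷ + 0 ∷ + 0 ∷ + 0 ∷ + 0 ∷ + 0 ∷ [])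
  ∷ (-[1+ 0 ] ∷ + 1 ∷ + 1 ∷ -[1+ 1 ] ∷ + 1 ∷ -[1+ 1 ] ∷ -[1+ 1 ] ∷ + 2 ∷ + 0 ∷ + 0 ∷ + 0 ∷ + 0 ∷ + 0 ∷ + 0 ∷ + 0 ∷ + 0 ∷ [])
  ∷ (-[1+ 0 ] ∷ + 0 ∷ + 0 ∷ + 0 ∷ + 0 ∷ + 0 ∷ + 0 ∷ + 0 ∷ + 1 ∷ + 0 ∷ + 0 ∷ + 0 ∷ + 0 ∷ + 0 ∷ + 0 ∷ + 0 ∷ [])
  ∷ (+ 1 ∷ -[1+ 0 ] ∷ + 0 ∷ + 0 ∷ + 0 ∷ + 0 ∷ + 0 ∷ + 0 ∷ -[1+ 0 ] ∷ + 2 ∷ + 0 ∷ + 0 ∷ + 0 ∷ + 0 ∷ + 0 ∷ + 0 ∷ [])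
  ∷ (+ 1 ∷ + 0 ∷ -[1+ 0 ] ∷ + 0 ∷ + 0 ∷ + 0 ∷ + 0 ∷ + 0 ∷ -[1+ 0 ] ∷ + 0 ∷ + 2 ∷ + 0 ∷ + 0 ∷ + 0 ∷ + 0 ∷ + 0 ∷ [])
  ∷ (-[1+ 0 ] ∷ + 1 ∷ + 1 ∷ -[1+ 1 ] ∷ + 0 ∷ + 0 ∷ + 0 ∷ + 0 ∷ + 1 ∷ -[1+ 1 ] ∷ -[1+ 1 ] ∷ + 2 ∷ + 0 ∷ + 0 ∷ + 0 ∷ + 0 ∷ [])
  ∷ (+ 1 ∷ + 0 ∷ + 0 ∷ + 0 ∷ -[1+ 0 ] ∷ + 0 ∷ + 0 ∷ + 0 ∷ -[1+ 0 ] ∷ + 0 ∷ + 0 ∷ + 0 ∷ + 2 ∷ + 0 ∷ + 0 ∷ + 0 ∷ [])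
  ∷ (-[1+ 0 ] ∷ + 1 ∷ + 0 ∷ + 0 ∷ + 1 ∷ -[1+ 1 ] ∷ + 0 ∷ + 0 ∷ + 1 ∷ -[1+ 1 ] ∷ + 0 ∷ + 0 ∷ -[1+ 1 ] ∷ + 2 ∷ + 0 ∷ + 0 ∷ [])
  ∷ (-[1+ 0 ] ∷ + 0 ∷ + 1 ∷ + 0 ∷ + 1 ∷ + 0 ∷ -[1+ 1 ] ∷ + 0 ∷ + 1 ∷ + 0 ∷ -[1+ 1 ] ∷ + 0 ∷ -[1+ 1 ] ∷ + 0 ∷ + 2 ∷ + 0 ∷ [])
  ∷ (+ 1 ∷ -[1+ 0 ] ∷ -[1+ 0 ] ∷ + 2 ∷ -[1+ 0 ] ∷ + 2 ∷ + 2 ∷ -[1+ 1 ] ∷ -[1+ 0 ] ∷ + 2 ∷ + 2 ∷ -[1+ 1 ] ∷ + 2 ∷ -[1+ 1 ] ∷ -[1+ 1 ] ∷ + 4 ∷ [])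
  ∷ []

-- The factor `d i` of the generator cancels against `4 / d i`, leaving 4 times the sum of
-- (-1)^|k∖i| over all masks i between j and k. These signs cancel in pairs unless j = k. Formally,
-- all 256 entries are evaluated and compared.
möbius-generator : ∀ k j →
  sum (λ i → lookup (lookup möbius k) i * generator i j) ≡ + 4 * δ k j
möbius-generator = from-yes (all? λ k → all? λ j →
  sum (λ i → lookup (lookup möbius k) i * generator i j) ≟ + 4 * δ k j)

-- With G the generator matrix, the coefficient vector is the product yN, and (yN)G = y(NG) = 4y.
-- The chain below is this associativity written with sums: distribute, interchange, then apply NG =
-- 4I.
4ℤ¹⁶⊆BW16 : ∀ (x y : Vector 16) → (∀ j → x j ≡ y j * + 4) → InBW16 x
4ℤ¹⁶⊆BW16 x y x≡4y = c , λ j → sym (begin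
  sumFin 16 (λ i → c i * generator i j)                ≡⟨ sumFin≡sum 16 (λ i → c i * generator i j) ⟩
  sum (λ i → c i * generator i j)                      ≡⟨ sum-cong-≗ (λ i → *-distribʳ-sum (generator i j) (λ k → y k * N k i)) ⟩
  sum (λ i → sum (λ k → y k * N k i * generator i j))  ≡⟨ ∑-comm (λ i k → y k * N k i * generator i j) ⟩
  sum (λ k → sum (λ i → y k * N k i * generator i j))  ≡⟨ sum-cong-≗ (λ k → inner k j) ⟩
  sum (λ k → y k * + 4 * δ k j)                        ≡⟨ sum-*δ (λ k → y k * + 4) j ⟩
  y j * + 4                                            ≡⟨ x≡4y j ⟨
  x j                                                  ∎)
  where
  N : Fin 16 → Fin 16 → ℤ
  N k = lookup (lookup möbius k)

  c : Fin 16 → ℤ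
  c i = sum (λ k → y k * N k i)

  inner : ∀ k j → sum (λ i → y k * N k i * generator i j) ≡ y k * + 4 * δ k j
  inner k j = begin
    sum (λ i → y k * N k i * generator i j)    ≡⟨ sum-cong-≗ (λ i → *-assoc (y k) (N k i) (generator i j)) ⟩
    sum (λ i → y k * (N k i * generator i j))  ≡⟨ *-distribˡ-sum (y k) (λ i → N k i * generator i j) ⟨
    y k * sum (λ i → N k i * generator i j)    ≡⟨ cong (y k *_) (möbius-generator k j) ⟩
    y k * (+ 4 * δ k j)                        ≡⟨ *-assoc (y k) (+ 4) (δ k j) ⟨
    y k * + 4 * δ k j                          ∎

base/4 : Vector 16
base/4 = lookup (+ 2 ∷ + 1 ∷ + 1 ∷ + 1 ∷ + 1 ∷ + 1 ∷ + 1 ∷ + 1 ∷ + 1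
               ∷ + 0 ∷ + 0 ∷ + 0 ∷ + 0 ∷ + 0 ∷ + 0 ∷ + 0 ∷ [])

base≡base/4*4 : ∀ j → base j ≡ base/4 j * + 4
base≡base/4*4 = from-yes (all? λ j → base j ≟ base/4 j * + 4)

sign-*ˡ : ∀ b a k → sign b (a * k) ≡ sign b a * k
sign-*ˡ true  a k = neg-distribˡ-* a k
sign-*ˡ false a k = refl

sign-square : ∀ b a → sign b a * sign b a ≡ a * a
sign-square false a = refl
sign-square true  a = begin
  - a * - a    ≡⟨ neg-distribˡ-* a (- a) ⟨
  - (a * - a)  ≡⟨ cong -_ (neg-distribʳ-* a a) ⟨
  - - (a * a)  ≡⟨ neg-involutive (a * a) ⟩
  a * a        ∎

normSq≡sum : ∀ {n} (x : Vector n) → normSq x ≡ sum (λ j → x j * x j)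
normSq≡sum {n} x = sumFin≡sum n (λ j → x j * x j)

-- Signs vanish on squaring, and the permutation only reorders the summands.
normSq-actB16 : ∀ π s x → normSq (actB16 π s x) ≡ normSq x
normSq-actB16 π s x = begin
  normSq (actB16 π s x)                        ≡⟨ normSq≡sum (actB16 π s x) ⟩
  sum (λ j → actB16 π s x j * actB16 π s x j)  ≡⟨ sum-cong-≗ (λ j → sign-square (s j) (x (π ⟨$⟩ʳ j))) ⟩
  sum (λ j → x (π ⟨$⟩ʳ j) * x (π ⟨$⟩ʳ j))      ≡⟨ sum-permute (λ j → x j * x j) π ⟨
  sum (λ j → x j * x j)                        ≡⟨ normSq≡sum x ⟨
  normSq x                                     ∎

-- Needed because `InOrbit` provides pointwise equality, not equality of functions.
normSq-cong : ∀ {n} {x y : Vector n} → (∀ j → x j ≡ y j) → normSq x ≡ normSq y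
normSq-cong {_} {x} {y} x≡y = begin
  normSq x               ≡⟨ normSq≡sum x ⟩
  sum (λ j → x j * x j)  ≡⟨ sum-cong-≗ (λ j → cong₂ _*_ (x≡y j) (x≡y j)) ⟩
  sum (λ j → y j * y j)  ≡⟨ normSq≡sum y ⟨
  normSq y               ∎

theorem7p4 : Σ ℤ λ m → ∀ (x : Vector 16) → InOrbit x → InBW16 x × normSq x ≡ m
-- The common squared norm is 8² + 8 · 4² = 192.
theorem7p4 = + 192 , λ x (π , s , x≡) →
  -- The action commutes with scaling by 4, so the quotient of `x` by 4 is the same signed
  -- permutation applied to `base/4`.
  4ℤ¹⁶⊆BW16 x (actB16 π s base/4)
    (λ j → trans (x≡ j) (trans (cong (sign (s j)) (base≡base/4*4 (π ⟨$⟩ʳ j)))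
                               (sign-*ˡ (s j) (base/4 (π ⟨$⟩ʳ j)) (+ 4)))) ,
  -- `normSq base` evaluates to `+ 192`, so no further equation is required.
  trans (normSq-cong x≡) (normSq-actB16 π s base)
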